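{- For every fixed natural number $k$, the satisfiability problem for AND-only formulas with $k$ Boolean negations is in PTIME; that is, for each fixed $k$ there is a deterministic polynomial-time algorithm which, given an AND-only propositional formula $f$ containing exactly $k$ occurrences of the negation connective $\neg$, decides whether there is a valuation satisfying $f$.
   Context: A propositional formula is AND-only if it contains only atomic propositions (propositional variables), the Boolean AND operator $\wedge$ and the Boolean NOT operator $\neg$; negations may be applied to arbitrary subformulas and may be nested. A valuation assigns true or false to each variable, and it satisfies a formula if the formula evaluates to true under it in the usual Boolean semantics. Polynomial time is measured in the size of the input formula, with $k$ treated as a constant. -}

module Defs where

open import Data.Bool.Base as Bool using (Bool; true; false; not)
open import Data.Fin.Base using (Fin)
open import Data.List.Base using (List; []; _∷_; _++_; length; map)
open import Data.Maybe.Base using (Maybe; just; nothing)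
open import Data.Nat.Base using (ℕ; zero; suc; _+_; _*_)
open import Data.Nat.Binary.Base using (ℕᵇ; zero; 2[1+_]; 1+[2_]; fromℕ)
open import Data.Product.Base using (Σ-syntax; ∃; _×_; _,_; proj₁)
open import Data.Vec.Base as Vec using (Vec; _∷_; replicate; zipWith)
open import Function.Base using (_∘_)
open import Function.Bundles using (_↔_)
open import Function.Definitions using (Injective)
open import Relation.Binary.PropositionalEquality.Core using (_≡_; _≢_)
open import Relation.Nullary.Reflects using (Reflects)

------------------------------------------------------------------------
-- AND-only formulas

infixr 6 _∧_
infix  7 ¬_

data Formula : Set where
  var : ℕ → Formula
  _∧_ : Formula → Formula → Formula
  ¬_  : Formula → Formula

negations : Formula → ℕ
negations (var x) = 0
negations (f ∧ g) = negations f + negations g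
negations (¬ f)   = suc (negations f)

Valuation : Set
Valuation = ℕ → Bool

⟦_⟧ : Formula → Valuation → Bool
⟦ var x ⟧ v = v x
⟦ f ∧ g ⟧ v = ⟦ f ⟧ v Bool.∧ ⟦ g ⟧ v
⟦ ¬ f   ⟧ v = not (⟦ f ⟧ v)

Satisfiable : Formula → Set
Satisfiable f = Σ[ v ∈ Valuation ] ⟦ f ⟧ v ≡ true

-- Formulas are written in Polish notation.  A variable is the letter `x`
-- followed by its index in bijective base 2 (digits 1 and 2, least
-- significant first), so that every string of digits is the numeral of
-- exactly one index and the length of an occurrence of the n-th variable
-- is logarithmic in n.

data Symbol : Set where
  and neg x one two : Symbol

digits : ℕᵇ → List Symbol
digits zero     = []
digits 2[1+ n ] = two ∷ digits n
digits 1+[2 n ] = one ∷ digits n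

encode : Formula → List Symbol
encode (var n) = x ∷ digits (fromℕ n)
encode (f ∧ g) = and ∷ encode f ++ encode g
encode (¬ f)   = neg ∷ encode f

------------------------------------------------------------------------
-- Deterministic multi-tape Turing machines

Finite : Set → Set
Finite A = ∃ λ n → A ↔ Fin n

data Direction : Set where
  left stay right : Direction

-- A two-way infinite tape.  Both lists start with the cell nearest to the
-- head; cells beyond the end of either list are blank.

record Tape (Γ : Set) : Set where
  constructor tape
  field
    before : List Γ
    head   : Γ
    after  : List Γ

module _ {Γ : Set} (blank : Γ) where

  load : List Γ → Tape Γ
  load []       = tape [] blank []
  load (a ∷ as) = tape [] a as

  move : Direction → Tape Γ → Tape Γ
  move stay  t                      = t
  move left  (tape []       h rs)   = tape [] blank (h ∷ rs)
  move left  (tape (l ∷ ls) h rs)   = tape ls l (h ∷ rs)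
  move right (tape ls h [])         = tape (h ∷ ls) blank []
  move right (tape ls h (r ∷ rs))   = tape (h ∷ ls) r rs

  writeAndMove : Γ × Direction → Tape Γ → Tape Γ
  writeAndMove (a , d) (tape ls _ rs) = move d (tape ls a rs)

record TuringMachine (A : Set) : Set₁ where
  field
    State        : Set
    State-finite : Finite State
    Γ            : Set
    Γ-finite     : Finite Γ
    blank        : Γ

    inject           : A → Γ
    inject-injective : Injective _≡_ _≡_ inject
    inject≢blank     : ∀ a → inject a ≢ blank

    -- One input tape, which is also writable, and any number of work tapes.
    workTapes : ℕ

    start : State

    -- `nothing` for running states; `just true` for accepting and
    -- `just false` for rejecting halting states.
    verdict : State → Maybe Bool

    -- The value of δ at a halting state is never used.
    δ : State → Vec Γ (suc workTapes) → State × Vec (Γ × Direction) (suc workTapes)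

module Execution {A : Set} (M : TuringMachine A) where

  open TuringMachine M

  record Config : Set where
    constructor config
    field
      state : State
      tapes : Vec (Tape Γ) (suc workTapes)

  open Config public

  initial : List A → Config
  initial w = config start (load blank (map inject w) ∷ replicate workTapes (load blank []))

  transition : Config → Config
  transition (config q ts) =
    let q′ , actions = δ q (Vec.map Tape.head ts)
    in config q′ (zipWith (writeAndMove blank) actions ts)

  step : Config → Config
  step c with verdict (state c)
  ... | just _  = c
  ... | nothing = transition c

  run : ℕ → Config → Config
  run zero    c = c
  run (suc t) c = run t (step c)

  -- Since `step` fixes halted configurations, this says that the machine
  -- halts on w after at most t steps with verdict b.
  HaltsWithin : ℕ → List A → Bool → Set
  HaltsWithin t w b = verdict (state (run t (initial w))) ≡ just b

------------------------------------------------------------------------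
-- Polynomial time

-- The polynomial with the given coefficients, constant term first.
polynomial : List ℕ → ℕ → ℕ
polynomial []       n = 0
polynomial (a ∷ as) n = a + n * polynomial as n

record DecisionProblem : Set₁ where
  field
    Instance : Set
    Alphabet : Set
    code     : Instance → List Alphabet
    Yes      : Instance → Set

-- Behaviour on strings that are not codes of instances is unconstrained.
DecidesInTime : (P : DecisionProblem) → TuringMachine (DecisionProblem.Alphabet P) →
                (ℕ → ℕ) → Set
DecidesInTime P M time =
  ∀ i → ∃ λ b → HaltsWithin (time (length (code i))) (code i) b × Reflects (Yes i) b
  where
  open DecisionProblem P
  open Execution M

PTIME : DecisionProblem → Set₁
PTIME P = Σ[ M ∈ TuringMachine (DecisionProblem.Alphabet P) ]
          ∃ λ coefficients → DecidesInTime P M (polynomial coefficients)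

ANDonlySAT : ℕ → DecisionProblem
ANDonlySAT k = record
  { Instance = Σ[ f ∈ Formula ] negations f ≡ k
  ; Alphabet = Symbol
  ; code     = encode ∘ proj₁
  ; Yes      = Satisfiable ∘ proj₁
  }

{-# OPTIONS --safe #-}
module Submission where

-- Guess the truth value of every negated subformula, and make true exactly those
-- variables that occur, outside further negations, in the whole formula or in a
-- negated subformula guessed to be true.  If a valuation satisfies f and the
-- guesses are the values it gives, then the proposed valuation lies below it and
-- agrees with it on every negated subformula, hence satisfies f too.  So f is
-- satisfiable iff one of the 2ᵏ proposed valuations satisfies it.
--
-- One machine serves all k: it keeps the guesses in the negation symbols of its
-- input, as the digits of a binary counter.  For each guess, a pass to the right
-- lists the variables to be made true, a pass to the left evaluates the Polish
-- term, and the counter is incremented.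

open import Data.Bool.Base as Bool using (Bool; true; false; not; if_then_else_; _∨_)
open import Data.Bool.Properties using (∨-zeroʳ; ∧-conicalˡ; ∧-conicalʳ)
open import Data.Empty using (⊥)
open import Data.Fin.Base using (Fin)
open import Data.Fin.Patterns using (0F; 1F; 2F; 3F; 4F; 5F; 6F)
open import Data.Fin.Properties using (+↔⊎; *↔×; 2↔Bool)
open import Data.List.Base using (List; []; _∷_; [_]; _++_; _ʳ++_; length; map; reverse)
open import Data.List.Properties
  using (++-assoc; ʳ++-defn; length-ʳ++; length-reverse; reverse-map;
         reverse-involutive; reverse-injective; length-++; map-++; ++-identityʳ; ∷-injectiveʳ)
open import Data.List.Relation.Unary.All as All using (All; []; _∷_)
open import Data.Maybe.Base using (Maybe; just; nothing)
open import Data.Nat.Base using (ℕ; zero; suc; _+_; _*_; _^_; _≤_; z≤n; s≤s)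
open import Data.Nat.Binary.Base using (ℕᵇ; zero; 2[1+_]; 1+[2_]; fromℕ)
open import Data.Nat.Binary.Properties using (fromℕ-injective)
open import Data.Nat.Properties
open import Data.Nat.Tactic.RingSolver using (solve-∀)
open import Data.Product.Base using (∃; _×_; _,_; proj₂)
open import Data.Product.Function.NonDependent.Propositional using (_×-cong_)
open import Data.Sum.Base using (_⊎_; inj₁; inj₂)
open import Data.Sum.Function.Propositional using (_⊎-cong_)
open import Data.Vec.Base using (Vec; []; _∷_)
open import Defs
open import Function.Bundles using (mk↔ₛ′)
open import Function.Construct.Composition using (_↔-∘_)
open import Function.Construct.Identity using (↔-id)
open import Function.Construct.Symmetry using (↔-sym)
open import Relation.Binary.PropositionalEquality hiding ([_])
open import Relation.Nullary.Reflects using (Reflects; ofʸ; ofⁿ)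

-- The machine.

data Mark : Set where
  and x : Mark
  digit : Bool → Mark
  -- On the input tape, a negation whose argument is guessed to have this value.
  bit   : Bool → Mark

Cell : Set
Cell = Maybe Mark

Cell-finite : Finite Cell
Cell-finite = 7 , mk↔ₛ′
  (λ { nothing → 0F ; (just and) → 1F ; (just x) → 2F
     ; (just (digit false)) → 3F ; (just (digit true)) → 4F
     ; (just (bit false)) → 5F ; (just (bit true)) → 6F })
  (λ { 0F → nothing ; 1F → just and ; 2F → just x
     ; 3F → just (digit false) ; 4F → just (digit true)
     ; 5F → just (bit false) ; 6F → just (bit true) })
  (λ { 0F → refl ; 1F → refl ; 2F → refl ; 3F → refl ; 4F → refl ; 5F → refl ; 6F → refl })
  (λ { nothing → refl ; (just and) → refl ; (just x) → refl
     ; (just (digit false)) → refl ; (just (digit true)) → refl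
     ; (just (bit false)) → refl ; (just (bit true)) → refl })

-- Negations are loaded as `bit false`, so the input already carries the first guess, all labels
-- false.
mark : Symbol → Mark
mark and = and
mark neg = bit false
mark x   = x
mark one = digit false
mark two = digit true

mark-injective : ∀ {a c} → just (mark a) ≡ just (mark c) → a ≡ c
mark-injective {and} {and} _ = refl
mark-injective {neg} {neg} _ = refl
mark-injective {x}   {x}   _ = refl
mark-injective {one} {one} _ = refl
mark-injective {two} {two} _ = refl

State : Set
State = Fin 7 ⊎ (Fin 7 × Bool)

pattern seek      = inj₁ 0F
pattern rewind    = inj₁ 1F
pattern pop       = inj₁ 2F
pattern compare   = inj₁ 3F
pattern skip      = inj₁ 4F
pattern back      = inj₁ 5F
pattern increment = inj₁ 6F

pattern parse c   = inj₂ (0F , c)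
pattern name c    = inj₂ (1F , c)
pattern eval a    = inj₂ (2F , a)
pattern conj a    = inj₂ (3F , a)
pattern found a   = inj₂ (4F , a)
pattern restore a = inj₂ (5F , a)
pattern halt a    = inj₂ (6F , a)

State-finite : Finite State
State-finite = 21 , ↔-sym +↔⊎ ↔-∘ (↔-id _ ⊎-cong (↔-sym *↔× ↔-∘ (↔-id _ ×-cong ↔-sym 2↔Bool)))

verdict : State → Maybe Bool
verdict (halt a) = just a
verdict _        = nothing

copy : Bool → Cell → Cell → Cell × Direction
copy true  i t = i , right
copy false i t = t , stay

-- The three tapes are the input, the list of variables to be made true, and a
-- stack.  In `parse c`, c is the label of the innermost enclosing negation, and
-- the stack holds the labels for the right conjuncts still to be read; in
-- `eval a`, a is the value of the subformula to the right of the head, and the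
-- stack holds the values of the subformulas after it.  The states from `compare`
-- to `restore` look up a variable in the list, from its last entry to its first,
-- comparing names from their last digits.
δ : State → Vec Cell 3 → State × Vec (Cell × Direction) 3
δ seek      (nothing ∷ t ∷ s ∷ [])            = rewind , (nothing , left) ∷ (t , stay) ∷ (s , stay) ∷ []
δ seek      (i ∷ t ∷ s ∷ [])                  = seek , (i , right) ∷ (t , stay) ∷ (s , stay) ∷ []
δ rewind    (nothing ∷ t ∷ s ∷ [])            =
  parse true , (nothing , right) ∷ (nothing , right) ∷ (just (bit false) , right) ∷ []
δ rewind    (i ∷ t ∷ s ∷ [])                  = rewind , (i , left) ∷ (t , stay) ∷ (s , stay) ∷ []
δ (parse c) (nothing ∷ t ∷ s ∷ [])            = eval false , (nothing , left) ∷ (nothing , stay) ∷ (s , stay) ∷ []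
δ (parse c) (just and ∷ t ∷ s ∷ [])           = parse c , (just and , right) ∷ (t , stay) ∷ (just (bit c) , right) ∷ []
δ (parse c) (just (bit a) ∷ t ∷ s ∷ [])       = parse a , (just (bit a) , right) ∷ (t , stay) ∷ (s , stay) ∷ []
δ (parse c) (just i ∷ t ∷ s ∷ [])             = name c , (just i , right) ∷ copy c (just i) t ∷ (s , stay) ∷ []
δ (name c)  (just (digit d) ∷ t ∷ s ∷ [])     =
  name c , (just (digit d) , right) ∷ copy c (just (digit d)) t ∷ (s , stay) ∷ []
δ (name c)  (i ∷ t ∷ s ∷ [])                  = pop , (i , stay) ∷ (t , stay) ∷ (s , left) ∷ []
δ pop       (i ∷ t ∷ just (bit c) ∷ [])       = parse c , (i , stay) ∷ (t , stay) ∷ (just (bit c) , stay) ∷ []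
δ pop       (i ∷ t ∷ s ∷ [])                  = halt false , (i , stay) ∷ (t , stay) ∷ (s , stay) ∷ []
δ (eval a)  (nothing ∷ t ∷ s ∷ [])            =
  (if a then halt true else increment) , (nothing , right) ∷ (t , stay) ∷ (s , stay) ∷ []
δ (eval a)  (just (bit c) ∷ t ∷ s ∷ [])       = eval (not a) , (just (bit c) , left) ∷ (t , stay) ∷ (s , stay) ∷ []
δ (eval a)  (just and ∷ t ∷ s ∷ [])           = conj a , (just and , left) ∷ (t , stay) ∷ (s , left) ∷ []
δ (eval a)  (just i ∷ t ∷ s ∷ [])             = compare , (just i , stay) ∷ (t , left) ∷ (just (bit a) , right) ∷ []
δ (conj a)  (i ∷ t ∷ just (bit c) ∷ [])       = eval (a Bool.∧ c) , (i , stay) ∷ (t , stay) ∷ (just (bit c) , stay) ∷ []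
δ (conj a)  (i ∷ t ∷ s ∷ [])                  = halt false , (i , stay) ∷ (t , stay) ∷ (s , stay) ∷ []
δ compare   (i ∷ nothing ∷ s ∷ [])            = found false , (i , stay) ∷ (nothing , stay) ∷ (s , stay) ∷ []
δ compare   (just x ∷ just x ∷ s ∷ [])        = found true , (just x , stay) ∷ (just x , stay) ∷ (s , stay) ∷ []
δ compare   (just (digit false) ∷ just (digit false) ∷ s ∷ []) =
  compare , (just (digit false) , left) ∷ (just (digit false) , left) ∷ (s , stay) ∷ []
δ compare   (just (digit true) ∷ just (digit true) ∷ s ∷ []) =
  compare , (just (digit true) , left) ∷ (just (digit true) , left) ∷ (s , stay) ∷ []
δ compare   (i ∷ t ∷ s ∷ [])                  = skip , (i , right) ∷ (t , stay) ∷ (s , stay) ∷ []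
δ skip      (i ∷ just x ∷ s ∷ [])             = back , (i , stay) ∷ (just x , left) ∷ (s , stay) ∷ []
δ skip      (i ∷ t ∷ s ∷ [])                  = skip , (i , stay) ∷ (t , left) ∷ (s , stay) ∷ []
δ back      (just (digit d) ∷ t ∷ s ∷ [])     = back , (just (digit d) , right) ∷ (t , stay) ∷ (s , stay) ∷ []
δ back      (i ∷ t ∷ s ∷ [])                  = compare , (i , left) ∷ (t , stay) ∷ (s , stay) ∷ []
δ (found a) (just x ∷ t ∷ s ∷ [])             = restore a , (just x , left) ∷ (t , right) ∷ (s , stay) ∷ []
δ (found a) (i ∷ t ∷ s ∷ [])                  = found a , (i , left) ∷ (t , stay) ∷ (s , stay) ∷ []
δ (restore a) (i ∷ nothing ∷ s ∷ [])          = eval a , (i , stay) ∷ (nothing , stay) ∷ (s , stay) ∷ []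
δ (restore a) (i ∷ t ∷ s ∷ [])                = restore a , (i , stay) ∷ (t , right) ∷ (s , stay) ∷ []
δ increment (nothing ∷ t ∷ s ∷ [])            = halt false , (nothing , stay) ∷ (t , stay) ∷ (s , stay) ∷ []
δ increment (just (bit false) ∷ t ∷ s ∷ [])   = rewind , (just (bit true) , left) ∷ (t , stay) ∷ (s , stay) ∷ []
δ increment (just (bit true) ∷ t ∷ s ∷ [])    = increment , (just (bit false) , right) ∷ (t , stay) ∷ (s , stay) ∷ []
δ increment (i ∷ t ∷ s ∷ [])                  = increment , (i , right) ∷ (t , stay) ∷ (s , stay) ∷ []
δ (halt a)  (i ∷ t ∷ s ∷ [])                  = halt a , (i , stay) ∷ (t , stay) ∷ (s , stay) ∷ []

machine : TuringMachine Symbol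
machine = record
  { State            = State
  ; State-finite     = State-finite
  ; Γ                = Cell
  ; Γ-finite         = Cell-finite
  ; blank            = nothing
  ; inject           = λ a → just (mark a)
  ; inject-injective = mark-injective
  ; inject≢blank     = λ _ ()
  ; workTapes        = 2
  ; start            = seek
  ; verdict          = verdict
  ; δ                = δ
  }

open Execution machine hiding (state)

-- Timed runs to a verdict, and head moves.

infix 4 _⇓⟨_⟩_

-- Runs are composed backwards: each `…-run` or `…-word` lemma below turns a verdict
-- from the configuration reached into one from the configuration left, so that the
-- single steps between them hold by computation.
data _⇓⟨_⟩_ : Config → ℕ → Bool → Set where
  halted : ∀ {t b ts} → config (halt b) ts ⇓⟨ t ⟩ b
  next   : ∀ {c t b} → step c ⇓⟨ t ⟩ b → c ⇓⟨ suc t ⟩ b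

run-halted : ∀ t {b ts} → run t (config (halt b) ts) ≡ config (halt b) ts
run-halted zero    = refl
run-halted (suc t) = run-halted t

⇓⇒run : ∀ {c t b} → c ⇓⟨ t ⟩ b → verdict (Config.state (run t c)) ≡ just b
⇓⇒run {t = t} halted = cong (λ c → verdict (Config.state c)) (run-halted t)
⇓⇒run (next p) = ⇓⇒run p

weaken : ∀ {c t u b} → t ≤ u → c ⇓⟨ t ⟩ b → c ⇓⟨ u ⟩ b
weaken _         halted   = halted
weaken (s≤s t≤u) (next p) = next (weaken t≤u p)

retime : ∀ {c t u b} → t ≡ u → c ⇓⟨ t ⟩ b → c ⇓⟨ u ⟩ b
retime refl p = p

slower : ∀ {c t u b} s → u ≡ t + s → c ⇓⟨ t ⟩ b → c ⇓⟨ u ⟩ b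
slower {t = t} s refl = weaken (m≤m+n t s)

-- The two time bounds may differ, so a rejecting run can be confronted with an accepting one of
-- unknown length.
⇓-deterministic : ∀ {c t u a b} → c ⇓⟨ t ⟩ a → c ⇓⟨ u ⟩ b → a ≡ b
⇓-deterministic halted   halted   = refl
⇓-deterministic halted   (next q) = ⇓-deterministic (halted {zero}) q
⇓-deterministic (next p) halted   = ⇓-deterministic p (halted {zero})
⇓-deterministic (next p) (next q) = ⇓-deterministic p q

-- The head stands just to the right, or just to the left, of the gap between two lists, so a word
-- can be crossed without splitting off its first or last cell.
rightward leftward : List Cell → List Cell → Tape Cell
rightward ls []       = tape ls nothing []
rightward ls (r ∷ rs) = tape ls r rs
leftward []       rs = tape [] nothing rs
leftward (l ∷ ls) rs = tape ls l rs

⟨_∣_∣_∣_⟩ : State → Tape Cell → Tape Cell → Tape Cell → Config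
⟨ q ∣ i ∣ t ∣ s ⟩ = config q (i ∷ t ∷ s ∷ [])

private
  variable
    L R S X Y : List Cell
    I T F W : Tape Cell
    q : State
    t : ℕ
    b : Bool
    h : Cell

-- `move` computes only once the neighbouring cell is known.  On the two work
-- tapes, what lies to the right of the data is left over from earlier
-- computations, so continuations accept any such remainder.
right₁ : ∀ R → ⟨ q ∣ rightward (h ∷ L) R ∣ T ∣ W ⟩ ⇓⟨ t ⟩ b →
         ⟨ q ∣ move nothing right (tape L h R) ∣ T ∣ W ⟩ ⇓⟨ t ⟩ b
right₁ []      k = k
right₁ (_ ∷ _) k = k

left₁ : ∀ L → ⟨ q ∣ leftward L (h ∷ R) ∣ T ∣ W ⟩ ⇓⟨ t ⟩ b →
        ⟨ q ∣ move nothing left (tape L h R) ∣ T ∣ W ⟩ ⇓⟨ t ⟩ b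
left₁ []      k = k
left₁ (_ ∷ _) k = k

right₂ : ∀ R → ⟨ q ∣ I ∣ rightward (h ∷ L) R ∣ W ⟩ ⇓⟨ t ⟩ b →
         ⟨ q ∣ I ∣ move nothing right (tape L h R) ∣ W ⟩ ⇓⟨ t ⟩ b
right₂ []      k = k
right₂ (_ ∷ _) k = k

left₂ : ∀ L → ⟨ q ∣ I ∣ leftward L (h ∷ R) ∣ W ⟩ ⇓⟨ t ⟩ b →
        ⟨ q ∣ I ∣ move nothing left (tape L h R) ∣ W ⟩ ⇓⟨ t ⟩ b
left₂ []      k = k
left₂ (_ ∷ _) k = k

append₂ : ∀ R → (∀ h′ R → ⟨ q ∣ I ∣ tape (h ∷ X) h′ R ∣ W ⟩ ⇓⟨ t ⟩ b) →
          ⟨ q ∣ I ∣ move nothing right (tape X h R) ∣ W ⟩ ⇓⟨ t ⟩ b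
append₂ []      k = k nothing []
append₂ (r ∷ R) k = k r R

push₃ : ∀ R → (∀ h′ R → ⟨ q ∣ I ∣ T ∣ tape (h ∷ S) h′ R ⟩ ⇓⟨ t ⟩ b) →
        ⟨ q ∣ I ∣ T ∣ move nothing right (tape S h R) ⟩ ⇓⟨ t ⟩ b
push₃ []      k = k nothing []
push₃ (r ∷ R) k = k r R

-- Formulas with guesses, and their codes on the tape.

data Labelling : Formula → Set where
  var   : ∀ n → Labelling (var n)
  _∧_   : ∀ {f g} → Labelling f → Labelling g → Labelling (f ∧ g)
  ¬[_]_ : ∀ {f} → Bool → Labelling f → Labelling (¬ f)

private
  variable
    f g : Formula

bits : ℕᵇ → List Bool
bits zero     = []
bits 2[1+ n ] = true ∷ bits n
bits 1+[2 n ] = false ∷ bits n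

numeral : ℕ → List Bool
numeral n = bits (fromℕ n)

cells : List Bool → List Cell
cells = map (λ d → just (digit d))

cells-ʳ++ : ∀ ds → cells ds ʳ++ X ≡ cells (reverse ds) ++ X
cells-ʳ++ {X} ds = trans (ʳ++-defn (cells ds)) (cong (_++ X) (sym (reverse-map _ ds)))

-- `word ℓ R` is the code of ℓ followed by R, and `wordʳ ℓ L` is its mirror image
-- followed by L: these are what lies on the two sides of the head before and
-- after the code.
word wordʳ : Labelling f → List Cell → List Cell
word (var n)     R = just x ∷ cells (numeral n) ++ R
word (ℓ ∧ m)     R = just and ∷ word ℓ (word m R)
word (¬[ a ] ℓ)  R = just (bit a) ∷ word ℓ R
wordʳ (var n)    L = cells (reverse (numeral n)) ++ just x ∷ L
wordʳ (ℓ ∧ m)    L = wordʳ m (wordʳ ℓ (just and ∷ L))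
wordʳ (¬[ a ] ℓ) L = wordʳ ℓ (just (bit a) ∷ L)

size : Formula → ℕ
size (var n) = suc (length (numeral n))
size (f ∧ g) = suc (size f + size g)
size (¬ f)   = suc (size f)

size-positive : ∀ f → 1 ≤ size f
size-positive (var n) = s≤s z≤n
size-positive (f ∧ g) = s≤s z≤n
size-positive (¬ f)   = s≤s z≤n

-- Numerals have no end marker: a name stops at the first cell that is not a digit, and these are
-- the cells that can follow it.
data Boundary : List Cell → Set where
  blank : Boundary (nothing ∷ R)
  and   : Boundary (just and ∷ R)
  x     : Boundary (just x ∷ R)
  bit   : ∀ {a} → Boundary (just (bit a) ∷ R)

word-boundary : (ℓ : Labelling f) → Boundary (word ℓ R)
word-boundary (var n)    = x
word-boundary (ℓ ∧ m)    = and
word-boundary (¬[ a ] ℓ) = bit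

-- Crossing a code in either direction.

seek-cells : ∀ ds → ⟨ seek ∣ rightward (cells ds ʳ++ L) R ∣ T ∣ W ⟩ ⇓⟨ t ⟩ b →
             ⟨ seek ∣ rightward L (cells ds ++ R) ∣ T ∣ W ⟩ ⇓⟨ length ds + t ⟩ b
seek-cells []       k = k
seek-cells (d ∷ ds) k = next (right₁ (cells ds ++ _) (seek-cells ds k))

increment-cells : ∀ ds → ⟨ increment ∣ rightward (cells ds ʳ++ L) R ∣ T ∣ W ⟩ ⇓⟨ t ⟩ b →
                  ⟨ increment ∣ rightward L (cells ds ++ R) ∣ T ∣ W ⟩ ⇓⟨ length ds + t ⟩ b
increment-cells []       k = k
increment-cells (d ∷ ds) k = next (right₁ (cells ds ++ _) (increment-cells ds k))

rewind-cells : ∀ ds → ⟨ rewind ∣ leftward L (cells ds ʳ++ R) ∣ T ∣ W ⟩ ⇓⟨ t ⟩ b →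
               ⟨ rewind ∣ leftward (cells ds ++ L) R ∣ T ∣ W ⟩ ⇓⟨ length ds + t ⟩ b
rewind-cells []       k = k
rewind-cells (d ∷ ds) k = next (left₁ (cells ds ++ _) (rewind-cells ds k))

seek-word : (ℓ : Labelling f) → ⟨ seek ∣ rightward (wordʳ ℓ L) R ∣ T ∣ W ⟩ ⇓⟨ t ⟩ b →
            ⟨ seek ∣ rightward L (word ℓ R) ∣ T ∣ W ⟩ ⇓⟨ size f + t ⟩ b
seek-word {L = L} (var n) k =
  next (right₁ _ (seek-cells (numeral n)
    (subst (λ L → ⟨ seek ∣ rightward L _ ∣ _ ∣ _ ⟩ ⇓⟨ _ ⟩ _) (sym (cells-ʳ++ (numeral n))) k)))
seek-word {f ∧ g} {t = t} (ℓ ∧ m) k =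
  next (retime (sym (+-assoc (size f) (size g) t)) (right₁ (word ℓ (word m _)) (seek-word ℓ (seek-word m k))))
seek-word (¬[ a ] ℓ) k = next (right₁ (word ℓ _) (seek-word ℓ k))

cells-reverse-ʳ++ : ∀ ds → cells (reverse ds) ʳ++ X ≡ cells ds ++ X
cells-reverse-ʳ++ ds = trans (cells-ʳ++ (reverse ds)) (cong (λ ds → cells ds ++ _) (reverse-involutive ds))

rewind-word : (ℓ : Labelling f) → ⟨ rewind ∣ leftward L (word ℓ R) ∣ T ∣ W ⟩ ⇓⟨ t ⟩ b →
              ⟨ rewind ∣ leftward (wordʳ ℓ L) R ∣ T ∣ W ⟩ ⇓⟨ size f + t ⟩ b
rewind-word {L = L} {t = t} (var n) k =
  retime (trans (cong (_+ suc t) (length-reverse (numeral n))) (+-suc _ _))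
    (rewind-cells (reverse (numeral n))
      (next (left₁ L (subst (λ R → ⟨ rewind ∣ leftward L (just x ∷ R) ∣ _ ∣ _ ⟩ ⇓⟨ _ ⟩ _)
                            (sym (cells-reverse-ʳ++ (numeral n))) k))))
rewind-word {f ∧ g} {t = t} (ℓ ∧ m) k =
  retime (eq (size f) (size g) t) (rewind-word m (rewind-word ℓ (next (left₁ _ k))))
  where
  eq : ∀ p q t → q + (p + suc t) ≡ suc (p + q) + t
  eq = solve-∀
rewind-word {¬ f} (¬[ a ] ℓ) k = retime (+-suc (size f) _) (rewind-word ℓ (next (left₁ _ k)))

-- The rightward pass: listing the variables to be made true.

reversed : ℕ → List Bool
reversed n = reverse (numeral n)

-- The list tape as seen from its right end: latest entry first, each name from its last digit back
-- to its `x`.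
entries : List ℕ → List Cell → List Cell
entries []       X = X
entries (n ∷ ns) X = cells (reversed n) ++ just x ∷ entries ns X

-- `c` tells whether the conjuncts at hand must be true. Below a negation only the guess for its
-- argument matters, so the label replaces `c`.
collect : Bool → Labelling f → List ℕ → List ℕ
collect c (var n)    ns = if c then n ∷ ns else ns
collect c (ℓ ∧ m)    ns = collect c m (collect c ℓ ns)
collect c (¬[ a ] ℓ) ns = collect a ℓ ns

name-end : ∀ c {s H H′} → Boundary R →
           ⟨ parse s ∣ rightward L R ∣ T ∣ tape S (just (bit s)) (H ∷ H′) ⟩ ⇓⟨ t ⟩ b →
           ⟨ name c ∣ rightward L R ∣ T ∣ tape (just (bit s) ∷ S) H H′ ⟩ ⇓⟨ 2 + t ⟩ b
name-end c blank k = next (next k)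
name-end c and   k = next (next k)
name-end c x     k = next (next k)
name-end c bit   k = next (next k)

stored : Bool → List Bool → List Cell → List Cell
stored c ds X = if c then cells ds ʳ++ X else X

name-cells : ∀ c ds {s} → Boundary R →
  (∀ h R₂ h′ R₃ → ⟨ parse s ∣ rightward (cells ds ʳ++ L) R ∣ tape (stored c ds X) h R₂ ∣ tape S h′ R₃ ⟩ ⇓⟨ t ⟩ b) →
  ∀ h R₂ h′ R₃ → ⟨ name c ∣ rightward L (cells ds ++ R) ∣ tape X h R₂ ∣ tape (just (bit s) ∷ S) h′ R₃ ⟩
                 ⇓⟨ length ds + (2 + t) ⟩ b
name-cells false []       B k h R₂ h′ R₃ = name-end _ B (k _ _ _ _)
name-cells true  []       B k h R₂ h′ R₃ = name-end _ B (k _ _ _ _)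
name-cells false (d ∷ ds) B k h R₂ h′ R₃ = next (right₁ (cells ds ++ _) (name-cells false ds B k _ _ _ _))
name-cells true  (d ∷ ds) B k h R₂ h′ R₃ =
  next (right₁ (cells ds ++ _) (append₂ R₂ λ h R₂ → name-cells true ds B k _ _ _ _))

-- Each conjunction pushes a label for its right conjunct and each variable pops one, so a formula
-- consumes exactly one label, `s`. For the whole formula it is the one pushed at the end of
-- `rewind`.
parse-word : ∀ c (ℓ : Labelling f) {s ns} → Boundary R →
  (∀ h R₂ h′ R₃ → ⟨ parse s ∣ rightward (wordʳ ℓ L) R ∣ tape (entries (collect c ℓ ns) X) h R₂ ∣ tape S h′ R₃ ⟩
                  ⇓⟨ t ⟩ b) →
  ∀ h R₂ h′ R₃ → ⟨ parse c ∣ rightward L (word ℓ R) ∣ tape (entries ns X) h R₂ ∣ tape (just (bit s) ∷ S) h′ R₃ ⟩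
                 ⇓⟨ 3 * size f + t ⟩ b
parse-word c (var n) B k h R₂ h′ R₃ =
  -- The factor 3 is attained by a name without digits: read `x`, notice the end of the name, pop.
  slower (2 * length (numeral n)) (eq (length (numeral n)) _) (start c B k h R₂ h′ R₃)
  where
  eq : ∀ n t → 3 * suc n + t ≡ suc (n + (2 + t)) + 2 * n
  eq = solve-∀
  start : ∀ c {s ns} → Boundary R →
    (∀ h R₂ h′ R₃ → ⟨ parse s ∣ rightward (wordʳ (var n) L) R
                              ∣ tape (entries (collect c (var n) ns) X) h R₂ ∣ tape S h′ R₃ ⟩ ⇓⟨ t ⟩ b) →
    ∀ h R₂ h′ R₃ → ⟨ parse c ∣ rightward L (word (var n) R)
                             ∣ tape (entries ns X) h R₂ ∣ tape (just (bit s) ∷ S) h′ R₃ ⟩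
                   ⇓⟨ suc (length (numeral n) + (2 + t)) ⟩ b
  start false B k h R₂ h′ R₃ = next (right₁ (cells (numeral n) ++ _) (name-cells false (numeral n) B
    (λ h R₂ h′ R₃ → subst (λ L → ⟨ parse _ ∣ rightward L _ ∣ _ ∣ _ ⟩ ⇓⟨ _ ⟩ _)
                          (sym (cells-ʳ++ (numeral n))) (k h R₂ h′ R₃)) _ _ _ _))
  start true B k h R₂ h′ R₃ = next (right₁ (cells (numeral n) ++ _) (append₂ R₂ λ h R₂ → name-cells true (numeral n) B
    (λ h R₂ h′ R₃ → subst₂ (λ L X → ⟨ parse _ ∣ rightward L _ ∣ tape X _ _ ∣ _ ⟩ ⇓⟨ _ ⟩ _)
                           (sym (cells-ʳ++ (numeral n))) (sym (cells-ʳ++ (numeral n))) (k h R₂ h′ R₃)) _ _ _ _))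
parse-word {f ∧ g} {t = t} c (ℓ ∧ m) B k h R₂ h′ R₃ = slower 2 (eq (size f) (size g) t)
  (next (right₁ (word ℓ (word m _)) (push₃ R₃ λ h′ R₃ →
    parse-word c ℓ (word-boundary m) (parse-word c m B k) _ _ _ _)))
  where
  eq : ∀ p q t → 3 * suc (p + q) + t ≡ suc (3 * p + (3 * q + t)) + 2
  eq = solve-∀
parse-word {¬ f} {t = t} c (¬[ a ] ℓ) B k h R₂ h′ R₃ = slower 2 (eq (size f) t)
  (next (right₁ (word ℓ _) (parse-word a ℓ B k _ _ _ _)))
  where
  eq : ∀ p t → 3 * suc p + t ≡ suc (3 * p + t) + 2
  eq = solve-∀

-- Looking up a variable in the list.

equal : List Bool → List Bool → Bool
equal []           []           = true
equal (false ∷ ds) (false ∷ es) = equal ds es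
equal (true ∷ ds)  (true ∷ es)  = equal ds es
equal _            _            = false

member : List Bool → List ℕ → Bool
member ds []       = false
member ds (n ∷ ns) = equal ds (reversed n) ∨ member ds ns

indicator : List ℕ → Valuation
indicator ns n = member (reversed n) ns

weight : List ℕ → ℕ
weight []       = 0
weight (n ∷ ns) = suc (length (numeral n)) + weight ns

-- The head of the tape F, which is on a blank, has been moved left over n marks,
-- so that it now has X on its left and Y on its right (one of them including the
-- cell under the head).
data Returns (F : Tape Cell) : ℕ → List Cell → List Cell → Set where
  here  : F ≡ tape X nothing Y → Returns F 0 X (nothing ∷ Y)
  cross : ∀ {n m} → Returns F n (just m ∷ X) Y → Returns F (suc n) X (just m ∷ Y)

restore-run : ∀ {a n} → Returns F n X Y → ⟨ eval a ∣ I ∣ F ∣ W ⟩ ⇓⟨ t ⟩ b →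
              ⟨ restore a ∣ I ∣ rightward X Y ∣ W ⟩ ⇓⟨ suc n + t ⟩ b
restore-run (here refl)     k = next k
restore-run (cross {Y = Y} r) k = next (right₂ Y (restore-run r k))

found-run : ∀ {a} us {ds} →
  ⟨ restore a ∣ leftward L (just x ∷ cells (us ʳ++ ds) ++ R) ∣ rightward (h ∷ X) Y ∣ W ⟩ ⇓⟨ t ⟩ b →
  ⟨ found a ∣ leftward (cells us ++ just x ∷ L) (cells ds ++ R) ∣ tape X h Y ∣ W ⟩ ⇓⟨ length us + suc t ⟩ b
found-run {L = L} {Y = Y} [] k = next (left₁ L (right₂ Y k))
found-run (u ∷ us) {ds}      k = next (left₁ (cells us ++ _) (found-run us {u ∷ ds} k))

skip-run : ∀ es {n} → Returns F n (cells es ++ just x ∷ X) Y →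
  (∀ {Y} → Returns F (suc (length es) + n) X Y → ⟨ back ∣ I ∣ leftward X Y ∣ W ⟩ ⇓⟨ t ⟩ b) →
  ⟨ skip ∣ I ∣ leftward (cells es ++ just x ∷ X) Y ∣ W ⟩ ⇓⟨ suc (length es) + t ⟩ b
skip-run {X = X} [] r k = next (left₂ X (k (cross r)))
skip-run {F = F} {X = X} (e ∷ es) {n} r k = next (left₂ (cells es ++ _) (skip-run es (cross r)
  (λ {Y} r → k (subst (λ n → Returns F n X Y) (cong suc (+-suc (length es) n)) r))))

back-run : ∀ ds {us} → Boundary R →
  ⟨ compare ∣ leftward (cells (ds ʳ++ us) ++ just x ∷ L) R ∣ T ∣ W ⟩ ⇓⟨ t ⟩ b →
  ⟨ back ∣ rightward (cells us ++ just x ∷ L) (cells ds ++ R) ∣ T ∣ W ⟩ ⇓⟨ length ds + suc t ⟩ b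
back-run []       {us} blank k = next (left₁ (cells us ++ _) k)
back-run []       {us} and   k = next (left₁ (cells us ++ _) k)
back-run []       {us} x     k = next (left₁ (cells us ++ _) k)
back-run []       {us} bit   k = next (left₁ (cells us ++ _) k)
back-run (d ∷ ds) {us} B     k = next (right₁ (cells ds ++ _) (back-run ds {d ∷ us} B k))

-- Each listed cell is charged `2 * u + 4`, which covers comparing, skipping the entry, returning on
-- the input, and later recrossing the entry. The rest pays for the way back to `x` on the input and
-- over the `n` marks already passed on the list.
lookup-cost : ℕ → List ℕ → ℕ → ℕ
lookup-cost u ns n = weight ns * (2 * u + 4) + (u + 3 + n)

-- Abstract, since the proofs found by the solver are expensive to normalise.
abstract

  absent-time : ∀ u n t → suc (u + suc (suc n + t)) ≡ u + 3 + n + t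
  absent-time = solve-∀

  entry-time : ∀ u e w n t →
    (suc e + w) * (2 * u + 4) + (u + 3 + n) + t
    ≡ suc (u + (2 * suc e + u + 1) + (w * (2 * u + 4) + (u + 3 + n)) + t) + e * (2 * u + 2)
  entry-time = solve-∀

  retry-time : ∀ v d e c u n t →
    v + (2 * suc e + (d + v) + 1) + (c + (u + 3 + n)) + t
    ≡ suc e + (d + suc (c + (u + 3 + (suc e + n)) + t)) + 2 * v
  retry-time = solve-∀

  match-time : ∀ u c n t →
    suc (0 + (2 * 1 + u + 1) + (c + (u + 3 + n)) + t) ≡ suc (suc (suc n + t)) + (2 * u + 4 + c)
  match-time = solve-∀

  digit-time : ∀ v e u c n t →
    suc (suc v + (2 * suc (suc e) + u + 1) + (c + (u + 3 + n)) + t)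
    ≡ suc (suc (v + (2 * suc e + u + 1) + (c + (u + 3 + suc n)) + t)) + 1
  digit-time = solve-∀

module _ (us : List Bool) {J L R : List Cell} (W : Tape Cell) (B : Boundary R) {t : ℕ} {b : Bool} where

  -- The name looked up is us, in reverse.  The input head is on its last digit, or
  -- further left, when the digits ds have been compared and vs are still to be.
  lookup-run : ∀ ns {n} → Returns F n (entries ns (nothing ∷ J)) Y →
    ⟨ eval (member us ns) ∣ leftward L (just x ∷ cells (reverse us) ++ R) ∣ F ∣ W ⟩ ⇓⟨ t ⟩ b →
    ⟨ compare ∣ leftward (cells us ++ just x ∷ L) R ∣ leftward (entries ns (nothing ∷ J)) Y ∣ W ⟩
      ⇓⟨ lookup-cost (length us) ns n + t ⟩ b

  retry-run : ∀ ns vs ds es {n} → ds ʳ++ vs ≡ us → Returns F n (cells es ++ just x ∷ entries ns (nothing ∷ J)) Y →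
    ⟨ eval (member us ns) ∣ leftward L (just x ∷ cells (reverse us) ++ R) ∣ F ∣ W ⟩ ⇓⟨ t ⟩ b →
    ⟨ skip ∣ rightward (cells vs ++ just x ∷ L) (cells ds ++ R)
           ∣ leftward (cells es ++ just x ∷ entries ns (nothing ∷ J)) Y ∣ W ⟩
      ⇓⟨ length vs + (2 * suc (length es) + length us + 1) + lookup-cost (length us) ns n + t ⟩ b

  compare-run : ∀ ns vs ds es {n} → ds ʳ++ vs ≡ us → Returns F n (cells es ++ just x ∷ entries ns (nothing ∷ J)) Y →
    ⟨ eval (equal vs es ∨ member us ns) ∣ leftward L (just x ∷ cells (reverse us) ++ R) ∣ F ∣ W ⟩ ⇓⟨ t ⟩ b →
    ⟨ compare ∣ leftward (cells vs ++ just x ∷ L) (cells ds ++ R)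
              ∣ leftward (cells es ++ just x ∷ entries ns (nothing ∷ J)) Y ∣ W ⟩
      ⇓⟨ suc (length vs + (2 * suc (length es) + length us + 1) + lookup-cost (length us) ns n + t) ⟩ b

  lookup-run [] {n} r k = retime (absent-time (length us) n t) (next (found-run us {[]} (restore-run r k)))
  lookup-run (m ∷ ns) {n} r k =
    slower (length (reversed m) * (2 * length us + 2))
      (trans (cong (λ l → (suc l + weight ns) * (2 * length us + 4) + (length us + 3 + n) + t)
                   (sym (length-reverse (numeral m))))
             (entry-time (length us) (length (reversed m)) (weight ns) n t))
      (compare-run ns us [] (reversed m) refl r k)

  retry-run ns vs ds es {n} refl r k =
    slower (2 * length vs)
      (trans (cong (λ l → length vs + (2 * suc (length es) + l + 1) + lookup-cost (length us) ns n + t)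
                   (length-ʳ++ ds))
             (retry-time (length vs) (length ds) (length es) (weight ns * (2 * length us + 4)) (length us) n t))
      (skip-run es r (λ r → back-run ds B (lookup-run ns r k)))

  compare-run ns [] ds [] {n} refl r k =
    slower (2 * length us + 4 + weight ns * (2 * length us + 4))
      (match-time (length us) (weight ns * (2 * length us + 4)) n t)
      (next (found-run [] {ds} (restore-run r
        (subst (λ ds → ⟨ eval true ∣ leftward L (just x ∷ cells ds ++ R) ∣ _ ∣ W ⟩ ⇓⟨ t ⟩ b)
               (reverse-involutive ds) k))))
  compare-run ns (true ∷ vs) ds (true ∷ es) {n} e r k =
    slower 1 (digit-time (length vs) (length es) (length us) (weight ns * (2 * length us + 4)) n t)
      (next (left₁ (cells vs ++ _) (left₂ (cells es ++ _) (compare-run ns vs (true ∷ ds) es e (cross r) k))))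
  compare-run ns (false ∷ vs) ds (false ∷ es) {n} e r k =
    slower 1 (digit-time (length vs) (length es) (length us) (weight ns * (2 * length us + 4)) n t)
      (next (left₁ (cells vs ++ _) (left₂ (cells es ++ _) (compare-run ns vs (false ∷ ds) es e (cross r) k))))
  -- On a mismatch the input head first steps right: it may be on the `x` of the name, which `back`
  -- would take for the end of the name.
  compare-run ns [] ds (d ∷ es) e r k =
    next (right₁ (cells ds ++ _) (retry-run ns [] ds (d ∷ es) e r k))
  compare-run ns (true ∷ vs) ds [] e r k =
    next (right₁ (cells ds ++ _) (retry-run ns (true ∷ vs) ds [] e r k))
  compare-run ns (false ∷ vs) ds [] e r k =
    next (right₁ (cells ds ++ _) (retry-run ns (false ∷ vs) ds [] e r k))
  compare-run ns (true ∷ vs) ds (false ∷ es) e r k =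
    next (right₁ (cells ds ++ _) (retry-run ns (true ∷ vs) ds (false ∷ es) e r k))
  compare-run ns (false ∷ vs) ds (true ∷ es) e r k =
    next (right₁ (cells ds ++ _) (retry-run ns (false ∷ vs) ds (true ∷ es) e r k))

-- The leftward pass: evaluation.

module _ (ns : List ℕ) {J K : List Cell} where

  listed : Tape Cell
  listed = tape (entries ns (nothing ∷ J)) nothing K

  -- Equal to `suc (lookup-cost 0 ns 0)`, the charge for a name without digits; longer names cost no
  -- more per symbol.
  symbol-cost : ℕ
  symbol-cost = 4 * weight ns + 4

  eval-name : ∀ us {a} → Boundary R →
    (∀ h R₃ → ⟨ eval (member us ns) ∣ leftward L (just x ∷ cells (reverse us) ++ R)
                                    ∣ listed ∣ tape (just (bit a) ∷ S) h R₃ ⟩ ⇓⟨ t ⟩ b) →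
    ∀ h R₃ → ⟨ eval a ∣ leftward (cells us ++ just x ∷ L) R ∣ listed ∣ tape S h R₃ ⟩
             ⇓⟨ suc (lookup-cost (length us) ns 0 + t) ⟩ b
  eval-name [] B k h R₃ =
    next (left₂ (entries ns _) (push₃ R₃ λ h R₃ → lookup-run [] _ B ns (here refl) (k h R₃)))
  eval-name (u ∷ us) B k h R₃ =
    next (left₂ (entries ns _) (push₃ R₃ λ h R₃ → lookup-run (u ∷ us) _ B ns (here refl) (k h R₃)))

  -- Read backwards, Polish notation is postfix. A variable pushes the previous value `a` and a
  -- conjunction pops the value of its right conjunct, so a formula pushes one value net.
  eval-word : (ℓ : Labelling f) → ∀ {a} → Boundary R →
    (∀ h R₃ → ⟨ eval (⟦ f ⟧ (indicator ns)) ∣ leftward L (word ℓ R) ∣ listed ∣ tape (just (bit a) ∷ S) h R₃ ⟩ ⇓⟨ t ⟩ b) →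
    ∀ h R₃ → ⟨ eval a ∣ leftward (wordʳ ℓ L) R ∣ listed ∣ tape S h R₃ ⟩ ⇓⟨ size f * symbol-cost + t ⟩ b
  eval-word {t = t} (var n) B k h R₃ =
    slower (2 * weight ns * l + 3 * l)
      (trans (eq l (weight ns) t)
             (cong (λ m → suc (weight ns * (2 * m + 4) + (m + 3 + 0) + t) + (2 * weight ns * l + 3 * l))
                   (sym (length-reverse (numeral n)))))
      (eval-name (reversed n) B (λ h R₃ →
        subst (λ ds → ⟨ eval (indicator ns n) ∣ leftward _ (just x ∷ cells ds ++ _) ∣ listed ∣ tape _ h R₃ ⟩ ⇓⟨ t ⟩ _)
              (sym (reverse-involutive (numeral n))) (k h R₃)) h R₃)
    where
    l : ℕ
    l = length (numeral n)
    eq : ∀ l w t → suc l * (4 * w + 4) + t ≡ suc (w * (2 * l + 4) + (l + 3 + 0) + t) + (2 * w * l + 3 * l)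
    eq = solve-∀
  eval-word {f ∧ g} {L = L} {t = t} (ℓ ∧ m) B k h R₃ =
    slower (4 * weight ns + 2) (eq (size f) (size g) (weight ns) t)
      (eval-word m B (eval-word ℓ (word-boundary m) (λ h R₃ → next (left₁ L (next (k _ _))))) h R₃)
    where
    eq : ∀ p q w t → suc (p + q) * (4 * w + 4) + t ≡ q * (4 * w + 4) + (p * (4 * w + 4) + (2 + t)) + (4 * w + 2)
    eq = solve-∀
  eval-word {¬ f} {L = L} {t = t} (¬[ c ] ℓ) B k h R₃ =
    slower (4 * weight ns + 3) (eq (size f) (weight ns) t)
      (eval-word ℓ B (λ h R₃ → next (left₁ L (k _ _))) h R₃)
    where
    eq : ∀ p w t → suc p * (4 * w + 4) + t ≡ p * (4 * w + 4) + suc t + (4 * w + 3)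
    eq = solve-∀

-- Incrementing the counter.

labelled : Bool → ∀ f → Labelling f
labelled a (var n) = var n
labelled a (f ∧ g) = labelled a f ∧ labelled a g
labelled a (¬ f)   = ¬[ a ] labelled a f

-- The labels form a binary counter with its least significant digit on the left.
data _↦_ : Labelling f → Labelling f → Set where
  flip  : {ℓ : Labelling f} → (¬[ false ] ℓ) ↦ (¬[ true ] ℓ)
  carry : {ℓ ℓ′ : Labelling f} → ℓ ↦ ℓ′ → (¬[ true ] ℓ) ↦ (¬[ false ] ℓ′)
  inˡ   : {ℓ ℓ′ : Labelling f} {m : Labelling g} → ℓ ↦ ℓ′ → (ℓ ∧ m) ↦ (ℓ′ ∧ m)
  inʳ   : {m m′ : Labelling g} → m ↦ m′ → (labelled true f ∧ m) ↦ (labelled false f ∧ m′)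

-- The carry passes through the whole code and resets every label on its way. This occurs in the
-- left conjunct for `inʳ`, and after the last guess.
overflow-run : ∀ f → ⟨ increment ∣ rightward (wordʳ (labelled false f) L) R ∣ T ∣ W ⟩ ⇓⟨ t ⟩ b →
               ⟨ increment ∣ rightward L (word (labelled true f) R) ∣ T ∣ W ⟩ ⇓⟨ size f + t ⟩ b
overflow-run (var n) k = next (right₁ (cells (numeral n) ++ _) (increment-cells (numeral n)
  (subst (λ L → ⟨ increment ∣ rightward L _ ∣ _ ∣ _ ⟩ ⇓⟨ _ ⟩ _) (sym (cells-ʳ++ (numeral n))) k)))
overflow-run {t = t} (f ∧ g) k =
  next (retime (sym (+-assoc (size f) (size g) t))
    (right₁ (word (labelled true f) _) (overflow-run f (overflow-run g k))))
overflow-run (¬ f) k = next (right₁ (word (labelled true f) _) (overflow-run f k))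

-- Each symbol is crossed at most once by the carry and once on the way back, whence the factor 2.
increment-run : {ℓ ℓ′ : Labelling f} → ℓ ↦ ℓ′ →
  ⟨ rewind ∣ leftward L (word ℓ′ R) ∣ T ∣ W ⟩ ⇓⟨ t ⟩ b →
  ⟨ increment ∣ rightward L (word ℓ R) ∣ T ∣ W ⟩ ⇓⟨ 2 * size f + t ⟩ b
increment-run {L = L} {t = t} (flip {f}) k =
  slower (2 * size f + 1) (eq (size f) t) (next (left₁ L k))
  where
  eq : ∀ p t → 2 * suc p + t ≡ suc t + (2 * p + 1)
  eq = solve-∀
increment-run {L = L} {t = t} (carry {f} {ℓ} i) k =
  retime (eq (size f) t) (next (right₁ (word ℓ _) (increment-run i (next (left₁ L k)))))
  where
  eq : ∀ p t → suc (2 * p + suc t) ≡ 2 * suc p + t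
  eq = solve-∀
increment-run {L = L} {t = t} (inˡ {f} {g} {ℓ} i) k =
  slower (2 * size g) (eq (size f) (size g) t) (next (right₁ (word ℓ _) (increment-run i (next (left₁ L k)))))
  where
  eq : ∀ p q t → 2 * suc (p + q) + t ≡ suc (2 * p + suc t) + 2 * q
  eq = solve-∀
increment-run {L = L} {t = t} (inʳ {g} {f} {m} i) k =
  retime (eq (size f) (size g) t) (next (right₁ (word (labelled true f) _) (overflow-run f
    (increment-run i (rewind-word (labelled false f) (next (left₁ L k)))))))
  where
  eq : ∀ p q t → suc (p + (2 * q + (p + suc t))) ≡ 2 * suc (p + q) + t
  eq = solve-∀

-- One trial.

trueNames : Labelling f → List ℕ
trueNames ℓ = collect true ℓ []

proposed : Labelling f → Valuation
proposed ℓ = indicator (trueNames ℓ)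

accepted : Labelling f → Bool
accepted {f} ℓ = ⟦ f ⟧ (proposed ℓ)

-- Each variable occurrence enters the list at most once, and its entry is as long as the
-- occurrence.
weight-collect : ∀ c (ℓ : Labelling f) ns → weight (collect c ℓ ns) ≤ size f + weight ns
weight-collect true  (var n) ns = ≤-refl
weight-collect false (var n) ns = m≤n+m (weight ns) _
weight-collect {f ∧ g} c (ℓ ∧ m) ns = begin
  weight (collect c m (collect c ℓ ns))  ≤⟨ weight-collect c m _ ⟩
  size g + weight (collect c ℓ ns)       ≤⟨ +-monoʳ-≤ (size g) (weight-collect c ℓ ns) ⟩
  size g + (size f + weight ns)          ≡⟨ eq (size f) (size g) (weight ns) ⟩
  size f + size g + weight ns            ≤⟨ n≤1+n _ ⟩
  suc (size f + size g + weight ns)      ∎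
  where
  open ≤-Reasoning
  eq : ∀ p q w → q + (p + w) ≡ p + q + w
  eq = solve-∀
weight-collect c (¬[ a ] ℓ) ns = ≤-trans (weight-collect a ℓ ns) (n≤1+n _)

-- The input tape at the start of every round. The trailing blank, stored by the first pass, is the
-- `Boundary` after the last name.
framed : Labelling f → Tape Cell
framed ℓ = tape [] nothing (word ℓ [ nothing ])

trial-cost : ℕ → ℕ
trial-cost s = 2 + 3 * s + s * (4 * s + 4)

-- The list and stack tapes are never cleaned: a round starts by separating off
-- what the previous rounds have left there.
trial-run : (ℓ : Labelling f) →
  (∀ T W → ⟨ eval (accepted ℓ) ∣ framed ℓ ∣ T ∣ W ⟩ ⇓⟨ t ⟩ b) →
  ∀ T W → ⟨ rewind ∣ framed ℓ ∣ T ∣ W ⟩ ⇓⟨ trial-cost (size f) + t ⟩ b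
trial-run {f} {t} ℓ k (tape J h R₂) (tape S h′ R₃) =
  weaken bound
    (next (right₁ (word ℓ [ nothing ]) (append₂ R₂ λ h R₂ → push₃ R₃ λ h′ R₃ →
      parse-word true ℓ {ns = []} blank (λ h R₂ h′ R₃ → next (left₁ (wordʳ ℓ _)
        (eval-word (trueNames ℓ) ℓ blank (λ h R₃ → k _ _) _ _))) _ _ _ _)))
  where
  open ≤-Reasoning
  w : ℕ
  w = weight (trueNames ℓ)
  eq : ∀ s t → suc (3 * s + suc (s * (4 * s + 4) + t)) ≡ 2 + 3 * s + s * (4 * s + 4) + t
  eq = solve-∀
  w≤size : w ≤ size f
  w≤size = ≤-trans (weight-collect true ℓ []) (≤-reflexive (+-identityʳ _))
  bound : suc (3 * size f + suc (size f * (4 * w + 4) + t)) ≤ trial-cost (size f) + t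
  bound = begin
    suc (3 * size f + suc (size f * (4 * w + 4) + t))
      ≤⟨ s≤s (+-monoʳ-≤ (3 * size f) (s≤s (+-monoˡ-≤ t (*-monoʳ-≤ (size f) (+-monoˡ-≤ 4 (*-monoʳ-≤ 4 w≤size)))))) ⟩
    suc (3 * size f + suc (size f * (4 * size f + 4) + t))
      ≡⟨ eq (size f) t ⟩
    trial-cost (size f) + t ∎

-- Counting through all labellings.

infixr 5 _◅_

data _↦⟨_⟩_ : Labelling f → ℕ → Labelling f → Set where
  ε   : {ℓ : Labelling f} → ℓ ↦⟨ 0 ⟩ ℓ
  _◅_ : ∀ {n} {ℓ m o : Labelling f} → ℓ ↦ m → m ↦⟨ n ⟩ o → ℓ ↦⟨ suc n ⟩ o

private
  variable
    n n′ : ℕ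
    ℓ ℓ′ ℓ″ : Labelling f

infixr 5 _◅◅_

_◅◅_ : ℓ ↦⟨ n ⟩ ℓ′ → ℓ′ ↦⟨ n′ ⟩ ℓ″ → ℓ ↦⟨ n + n′ ⟩ ℓ″
ε       ◅◅ q = q
(i ◅ p) ◅◅ q = i ◅ (p ◅◅ q)

-- The outer label is the less significant digit, so each step inside takes a full cycle of two
-- steps outside.
¬-path : ∀ a → ℓ ↦⟨ n ⟩ ℓ′ → (¬[ a ] ℓ) ↦⟨ n * 2 ⟩ (¬[ a ] ℓ′)
¬-path a     ε       = ε
¬-path false (i ◅ p) = flip ◅ carry i ◅ ¬-path false p
¬-path true  (i ◅ p) = carry i ◅ flip ◅ ¬-path true p

∧-pathˡ : {m : Labelling g} → ℓ ↦⟨ n ⟩ ℓ′ → (ℓ ∧ m) ↦⟨ n ⟩ (ℓ′ ∧ m)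
∧-pathˡ ε       = ε
∧-pathˡ (i ◅ p) = inˡ i ◅ ∧-pathˡ p

-- Each step on the right takes a full cycle on the left: `N` steps to all true, and one that
-- carries.
∧-pathʳ : ∀ {N} → labelled false f ↦⟨ N ⟩ labelled true f →
          ℓ ↦⟨ n ⟩ ℓ′ → (labelled false f ∧ ℓ) ↦⟨ n * (N + 1) ⟩ (labelled false f ∧ ℓ′)
∧-pathʳ full ε       = ε
∧-pathʳ full (i ◅ p) = (∧-pathˡ full ◅◅ inʳ i ◅ ε) ◅◅ ∧-pathʳ full p

steps : Formula → ℕ
steps (var n) = 0
steps (f ∧ g) = steps g * (steps f + 1) + steps f
steps (¬ f)   = steps f * 2 + 1

full-path : ∀ f → labelled false f ↦⟨ steps f ⟩ labelled true f
full-path (var n) = ε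
full-path (f ∧ g) = ∧-pathʳ (full-path f) (full-path g) ◅◅ ∧-pathˡ (full-path f)
full-path (¬ f)   = ¬-path false (full-path f) ◅◅ (flip ◅ ε)

-- Every guess is reachable. The length is left open, since these paths serve correctness and not
-- the time bound.
path-to : (ℓ : Labelling f) → ∃ λ n → labelled false f ↦⟨ n ⟩ ℓ
path-to (var n)         = _ , ε
path-to {f ∧ g} (ℓ ∧ m) = _ , ∧-pathʳ (full-path f) (proj₂ (path-to m)) ◅◅ ∧-pathˡ (proj₂ (path-to ℓ))
path-to (¬[ false ] ℓ)  = _ , ¬-path false (proj₂ (path-to ℓ))
path-to (¬[ true ] ℓ)   = _ , ¬-path false (proj₂ (path-to ℓ)) ◅◅ (flip ◅ ε)

suc-steps : ∀ f → suc (steps f) ≡ 2 ^ negations f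
suc-steps (var n) = refl
suc-steps (f ∧ g) = begin
  suc (steps g * (steps f + 1) + steps f)   ≡⟨ eq (steps f) (steps g) ⟩
  suc (steps f) * suc (steps g)             ≡⟨ cong₂ _*_ (suc-steps f) (suc-steps g) ⟩
  2 ^ negations f * 2 ^ negations g         ≡⟨ ^-distribˡ-+-* 2 (negations f) (negations g) ⟨
  2 ^ (negations f + negations g)           ∎
  where
  open ≡-Reasoning
  eq : ∀ p q → suc (q * (p + 1) + p) ≡ suc p * suc q
  eq = solve-∀
suc-steps (¬ f) = trans (eq (steps f)) (cong (2 *_) (suc-steps f))
  where
  eq : ∀ p → suc (p * 2 + 1) ≡ 2 * suc p
  eq = solve-∀

-- The search.

-- A trial, one step to act on its outcome, and an increment of at most `2 * s` steps.
round-cost : ℕ → ℕ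
round-cost s = 3 + 9 * s + 4 * (s * s)

accept-run : (ℓ : Labelling f) → accepted ℓ ≡ true →
             ∀ T W → ⟨ rewind ∣ framed ℓ ∣ T ∣ W ⟩ ⇓⟨ round-cost (size f) ⟩ true
accept-run {f} ℓ acc T W = slower (2 * size f) (eq (size f)) (trial-run ℓ verdict-run T W)
  where
  verdict-run : ∀ T W → ⟨ eval (accepted ℓ) ∣ framed ℓ ∣ T ∣ W ⟩ ⇓⟨ 1 ⟩ true
  verdict-run rewrite acc = λ T W → next halted
  eq : ∀ s → 3 + 9 * s + 4 * (s * s) ≡ 2 + 3 * s + s * (4 * s + 4) + 1 + 2 * s
  eq = solve-∀

reject-run : (ℓ : Labelling f) → accepted ℓ ≡ false →
  (∀ T W → ⟨ increment ∣ rightward [ nothing ] (word ℓ [ nothing ]) ∣ T ∣ W ⟩ ⇓⟨ 2 * size f + t ⟩ b) →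
  ∀ T W → ⟨ rewind ∣ framed ℓ ∣ T ∣ W ⟩ ⇓⟨ round-cost (size f) + t ⟩ b
reject-run {f} {t} {b} ℓ rej k T W = retime (eq (size f) t) (trial-run ℓ verdict-run T W)
  where
  verdict-run : ∀ T W → ⟨ eval (accepted ℓ) ∣ framed ℓ ∣ T ∣ W ⟩ ⇓⟨ suc (2 * size f + t) ⟩ b
  verdict-run rewrite rej = λ T W → next (right₁ (word ℓ [ nothing ]) (k T W))
  eq : ∀ s t → 2 + 3 * s + s * (4 * s + 4) + suc (2 * s + t) ≡ 3 + 9 * s + 4 * (s * s) + t
  eq = solve-∀

-- Only acceptance is justified here, by the labelling at which the search stops. Rejection is
-- justified later, from `accepting-path` and determinism.
search : {ℓ : Labelling f} → ℓ ↦⟨ n ⟩ labelled true f →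
  ∃ λ b → (b ≡ true → Satisfiable f) × (∀ T W → ⟨ rewind ∣ framed ℓ ∣ T ∣ W ⟩ ⇓⟨ suc n * round-cost (size f) ⟩ b)
search {f} {n} {ℓ} p with accepted ℓ in eq
... | true = true , (λ _ → proposed ℓ , eq) , λ T W → weaken (m≤m+n _ _) (accept-run ℓ eq T W)
search {f} {ℓ = ℓ} ε | false =
  false , (λ ()) , reject-run ℓ eq λ T W →
    -- Overflow takes `size f` steps and rejecting at the blank one more, within `2 * size f`
    -- because a code is never empty.
    weaken (≤-trans (+-monoʳ-≤ (size f) (≤-trans (size-positive f) (m≤m+n _ 0))) (m≤m+n _ 0))
      (overflow-run f (next halted))
search (i ◅ p) | false = let b , sat , searched = search p in
  b , sat , reject-run _ eq λ T W → increment-run i (searched T W)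

-- The run reaches `m` unless an earlier labelling is accepted first; it accepts in both cases.
accepting-path : {ℓ m : Labelling f} → ℓ ↦⟨ n ⟩ m → accepted m ≡ true →
  ∃ λ t → ∀ T W → ⟨ rewind ∣ framed ℓ ∣ T ∣ W ⟩ ⇓⟨ t ⟩ true
accepting-path ε acc = _ , accept-run _ acc
accepting-path {ℓ = ℓ} (i ◅ p) acc with accepted ℓ in eq
... | true  = _ , accept-run ℓ eq
... | false = _ , reject-run ℓ eq λ T W → increment-run i (proj₂ (accepting-path p acc) T W)

-- A satisfiable formula has an accepted labelling.

equal-refl : ∀ ds → equal ds ds ≡ true
equal-refl []           = refl
equal-refl (false ∷ ds) = equal-refl ds
equal-refl (true ∷ ds)  = equal-refl ds

equal-sound : ∀ ds es → equal ds es ≡ true → ds ≡ es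
equal-sound []           []           _ = refl
equal-sound (false ∷ ds) (false ∷ es) p = cong (false ∷_) (equal-sound ds es p)
equal-sound (true ∷ ds)  (true ∷ es)  p = cong (true ∷_) (equal-sound ds es p)

bits-injective : ∀ {m n} → bits m ≡ bits n → m ≡ n
bits-injective {zero}     {zero}     _ = refl
bits-injective {2[1+ m ]} {2[1+ n ]} p = cong 2[1+_] (bits-injective (∷-injectiveʳ p))
bits-injective {1+[2 m ]} {1+[2 n ]} p = cong 1+[2_] (bits-injective (∷-injectiveʳ p))

reversed-injective : ∀ {m n} → reversed m ≡ reversed n → m ≡ n
reversed-injective p = fromℕ-injective (bits-injective (reverse-injective p))

member-sound : ∀ {v : Valuation} {n} ns → All (λ m → v m ≡ true) ns → indicator ns n ≡ true → v n ≡ true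
member-sound {v} {n} (m ∷ ns) (vm ∷ vns) p with equal (reversed n) (reversed m) in eq
... | true  = trans (cong v (reversed-injective (equal-sound _ _ eq))) vm
... | false = member-sound ns vns p

member-complete : ∀ ns → All (λ n → indicator ns n ≡ true) ns
member-complete []       = []
member-complete (n ∷ ns) =
  cong (_∨ indicator ns n) (equal-refl (reversed n)) ∷
  All.map (λ {m} p → trans (cong (equal (reversed m) (reversed n) ∨_) p) (∨-zeroʳ _)) (member-complete ns)

truthful : Valuation → ∀ f → Labelling f
truthful v (var n) = var n
truthful v (f ∧ g) = truthful v f ∧ truthful v g
truthful v (¬ f)   = ¬[ ⟦ f ⟧ v ] truthful v f

-- A truthful label `true` sits on a subformula that `v` satisfies, and `v` then satisfies all its
-- conjuncts, hence every variable that gets listed.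
collect-true : ∀ v c f {ns} → (c ≡ true → ⟦ f ⟧ v ≡ true) →
               All (λ n → v n ≡ true) ns → All (λ n → v n ≡ true) (collect c (truthful v f) ns)
collect-true v false (var n) p vns = vns
collect-true v true  (var n) p vns = p refl ∷ vns
collect-true v c     (f ∧ g) p vns =
  collect-true v c g (λ q → ∧-conicalʳ (⟦ f ⟧ v) _ (p q))
    (collect-true v c f (λ q → ∧-conicalˡ _ (⟦ g ⟧ v) (p q)) vns)
collect-true v c     (¬ f)   p vns = collect-true v (⟦ f ⟧ v) f (λ q → q) vns

collect-⊇ : ∀ {P : ℕ → Set} c (ℓ : Labelling f) {ns} → All P (collect c ℓ ns) → All P ns
collect-⊇ false (var n)    p       = p
collect-⊇ true  (var n)    (_ ∷ p) = p
collect-⊇ c     (ℓ ∧ m)    p       = collect-⊇ c ℓ (collect-⊇ c m p)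
collect-⊇ c     (¬[ a ] ℓ) p       = collect-⊇ a ℓ p

module _ {v w : Valuation} (w≤v : ∀ n → w n ≡ true → v n ≡ true) where

  -- Outside negations formulas are monotone. At variables `below` uses `w≤v`, and `above` uses that
  -- the variables of a true subformula are listed. `agree` picks the one that the value under `v`
  -- calls for, and carries both across negations.
  below : ∀ f {ns} → All (λ n → w n ≡ true) (collect false (truthful v f) ns) → ⟦ f ⟧ w ≡ true → ⟦ f ⟧ v ≡ true
  above : ∀ f {ns} → All (λ n → w n ≡ true) (collect true (truthful v f) ns) → ⟦ f ⟧ v ≡ true → ⟦ f ⟧ w ≡ true
  agree : ∀ f {ns} → All (λ n → w n ≡ true) (collect (⟦ f ⟧ v) (truthful v f) ns) → ⟦ f ⟧ w ≡ ⟦ f ⟧ v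

  below (var n) ws p = w≤v n p
  below (f ∧ g) ws p = cong₂ Bool._∧_
    (below f (collect-⊇ false (truthful v g) ws) (∧-conicalˡ _ (⟦ g ⟧ w) p))
    (below g ws (∧-conicalʳ (⟦ f ⟧ w) _ p))
  below (¬ f)   ws p = trans (cong not (sym (agree f ws))) p

  above (var n) (wn ∷ _) p = wn
  above (f ∧ g) ws       p = cong₂ Bool._∧_
    (above f (collect-⊇ true (truthful v g) ws) (∧-conicalˡ _ (⟦ g ⟧ v) p))
    (above g ws (∧-conicalʳ (⟦ f ⟧ v) _ p))
  above (¬ f)   ws       p = trans (cong not (agree f ws)) p

  agree f ws with ⟦ f ⟧ v in eqᵥ | ⟦ f ⟧ w in eqʷ
  ... | true  | a     = trans (sym eqʷ) (above f ws eqᵥ)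
  ... | false | false = refl
  ... | false | true  = trans (sym (below f ws eqʷ)) eqᵥ

truthful-accepted : ∀ v f → ⟦ f ⟧ v ≡ true → accepted (truthful v f) ≡ true
truthful-accepted v f p =
  above (λ n → member-sound _ (collect-true v true f (λ _ → p) [])) f (member-complete (trueNames (truthful v f))) p

-- The encoded input and the total time.

symbols : List Symbol → List Cell
symbols = map (λ a → just (mark a))

digits-cells : ∀ n → symbols (digits n) ≡ cells (bits n)
digits-cells zero     = refl
digits-cells 2[1+ n ] = cong (just (digit true) ∷_) (digits-cells n)
digits-cells 1+[2 n ] = cong (just (digit false) ∷_) (digits-cells n)

encode-word : ∀ f R → symbols (encode f) ++ R ≡ word (labelled false f) R
encode-word (var n) R = cong (λ w → just x ∷ w ++ R) (digits-cells (fromℕ n))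
encode-word (f ∧ g) R = cong (just and ∷_) (begin
  symbols (encode f ++ encode g) ++ R                ≡⟨ cong (_++ R) (map-++ _ (encode f) (encode g)) ⟩
  (symbols (encode f) ++ symbols (encode g)) ++ R    ≡⟨ ++-assoc (symbols (encode f)) _ R ⟩
  symbols (encode f) ++ symbols (encode g) ++ R      ≡⟨ cong (symbols (encode f) ++_) (encode-word g R) ⟩
  symbols (encode f) ++ word (labelled false g) R    ≡⟨ encode-word f _ ⟩
  word (labelled false f) (word (labelled false g) R) ∎)
  where open ≡-Reasoning
encode-word (¬ f) R = cong (just (bit false) ∷_) (encode-word f R)

length-digits : ∀ n → length (digits n) ≡ length (bits n)
length-digits zero     = refl
length-digits 2[1+ n ] = cong suc (length-digits n)
length-digits 1+[2 n ] = cong suc (length-digits n)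

length-encode : ∀ f → length (encode f) ≡ size f
length-encode (var n) = cong suc (length-digits (fromℕ n))
length-encode (f ∧ g) =
  cong suc (trans (length-++ (encode f)) (cong₂ _+_ (length-encode f) (length-encode g)))
length-encode (¬ f)   = cong suc (length-encode f)

load-rightward : ∀ R → load nothing R ≡ rightward [] R
load-rightward []      = refl
load-rightward (_ ∷ _) = refl

initial-tape : ∀ f → load nothing (symbols (encode f)) ≡ rightward [] (word (labelled false f) [])
initial-tape f = trans (load-rightward _)
  (cong (rightward []) (trans (sym (++-identityʳ _)) (encode-word f [])))

start-run : ∀ f → (∀ T W → ⟨ rewind ∣ framed (labelled false f) ∣ T ∣ W ⟩ ⇓⟨ t ⟩ b) →
            initial (encode f) ⇓⟨ size f + suc (size f + t) ⟩ b
start-run {t} f k = subst (λ I → ⟨ seek ∣ I ∣ _ ∣ _ ⟩ ⇓⟨ size f + suc (size f + t) ⟩ _) (sym (initial-tape f))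
  (seek-word ℓ₀ (next (left₁ (wordʳ ℓ₀ []) (rewind-word ℓ₀ (k _ _)))))
  where
  ℓ₀ : Labelling f
  ℓ₀ = labelled false f

-- For a code of length `s`, the first pass there and back takes `2 * s + 1` steps; at most `c`
-- rounds of `round-cost s` follow.
coefficients : ℕ → List ℕ
coefficients c = 1 + c * 3 ∷ 2 + c * 9 ∷ c * 4 ∷ []

total-cost : ∀ f → size f + suc (size f + suc (steps f) * round-cost (size f))
                   ≡ polynomial (coefficients (2 ^ negations f)) (length (encode f))
total-cost f = begin
  s + suc (s + suc (steps f) * round-cost s)     ≡⟨ cong (λ c → s + suc (s + c * round-cost s)) (suc-steps f) ⟩
  s + suc (s + c * round-cost s)                 ≡⟨ eq s c ⟩
  polynomial (coefficients c) s                  ≡⟨ cong (polynomial (coefficients c)) (length-encode f) ⟨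
  polynomial (coefficients c) (length (encode f)) ∎
  where
  open ≡-Reasoning
  s c : ℕ
  s = size f
  c = 2 ^ negations f
  eq : ∀ s c → s + suc (s + c * (3 + 9 * s + 4 * (s * s)))
             ≡ 1 + c * 3 + s * (2 + c * 9 + s * (c * 4 + s * 0))
  eq = solve-∀

theorem2p4 : (k : ℕ) → PTIME (ANDonlySAT k)
theorem2p4 k = machine , coefficients (2 ^ k) , decides
  where
  decides : DecidesInTime (ANDonlySAT k) machine (polynomial (coefficients (2 ^ k)))
  decides (f , refl) with search (full-path f)
  ... | b , sound , searched =
    b , ⇓⇒run (retime (total-cost f) (start-run f searched)) , reflects b sound searched
    where
    reflects : ∀ b → (b ≡ true → Satisfiable f) →
      (∀ T W → ⟨ rewind ∣ framed (labelled false f) ∣ T ∣ W ⟩ ⇓⟨ suc (steps f) * round-cost (size f) ⟩ b) →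
      Reflects (Satisfiable f) b
    reflects true  sound _        = ofʸ (sound refl)
    reflects false _     searched = ofⁿ unsatisfiable
      where
      empty : Tape Cell
      empty = load nothing []
      unsatisfiable : Satisfiable f → ⊥
      -- The counter would reach the truthful labelling of `v` or accept sooner, so the
      -- configuration that rejects would also accept.
      unsatisfiable (v , p) with accepting-path (proj₂ (path-to (truthful v f))) (truthful-accepted v f p)
      ... | _ , accepting with ⇓-deterministic (searched empty empty) (accepting empty empty)
      ...   | ()
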